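{- Let $K_2$ be the complete graph on two vertices. Then $\pi(K_2) = 2$, whereas $\pi_s(K_2) = 3$.
   Context: All graphs are simple (no loops and no multiple edges). A configuration of $t$ pebbles on $G$ is a function $C : V(G) \to \{0,1,2,\dots\}$ with $\sum_{v} C(v) = t$; $C(v)$ is the number of pebbles on $v$. A pebbling move consists of choosing a vertex $u$ carrying at least two pebbles and a vertex $v$ adjacent to $u$, taking two pebbles off $u$, placing one of them on $v$ and removing the other from the game. Pebbling moves are applied in finite (possibly empty) sequences. The pebbling number $\pi(G)$ is the smallest $t$ such that, for every configuration of $t$ pebbles on $G$ and every vertex $r$ (the target vertex), there is a finite sequence of pebbling moves after which at least one pebble is on $r$. The singular pebbling number $\pi_s(G)$ is the smallest $t$ such that, for every configuration of at least $t$ pebbles on $G$ and every target vertex $r$, there is a finite sequence of pebbling moves after which exactly one pebble is on $r$. -}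

module Defs where

open import Algebra.Properties.Monoid.Sum using (sum)
open import Data.Fin.Base using (Fin)
open import Data.Nat.Base using (ℕ; suc; _∸_; _≤_)
open import Data.Nat.Properties using (+-0-monoid)
open import Data.Product.Base using (_×_; ∃-syntax)
open import Data.Vec.Functional using (Vector; updateAt)
open import Level using (0ℓ)
open import Relation.Binary.Construct.Closure.ReflexiveTransitive using (Star)
open import Relation.Binary.Core using (Rel)
open import Relation.Binary.Definitions using (Irreflexive; Symmetric)
open import Relation.Binary.PropositionalEquality.Core using (_≡_; _≢_; ≢-sym)

-- Finite simple graphs, with vertex set Fin n.
record Graph (n : ℕ) : Set₁ where
  field
    Adj         : Rel (Fin n) 0ℓ
    symmetric   : Symmetric Adj
    irreflexive : Irreflexive _≡_ Adj

complete : (n : ℕ) → Graph n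
complete n = record
  { Adj         = _≢_
  ; symmetric   = ≢-sym
  ; irreflexive = λ u≡v u≢v → u≢v u≡v
  }

Configuration : ℕ → Set
Configuration n = Vector ℕ n

size : ∀ {n} → Configuration n → ℕ
size = sum +-0-monoid

module _ {n : ℕ} (G : Graph n) where
  open Graph G

  -- The truncated subtraction is exact because u carries at least two pebbles.
  data Move (C : Configuration n) : Configuration n → Set where
    move : (u v : Fin n) → Adj u v → 2 ≤ C u →
           Move C (updateAt (updateAt C u (_∸ 2)) v suc)

  Reachable : Rel (Configuration n) 0ℓ
  Reachable = Star Move

  AlwaysSolvable : ℕ → Set
  AlwaysSolvable t = (C : Configuration n) → size C ≡ t → (r : Fin n) →
                     ∃[ D ] (Reachable C D × 1 ≤ D r)

  AlwaysSingularlySolvable : ℕ → Set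
  AlwaysSingularlySolvable t = (C : Configuration n) → t ≤ size C → (r : Fin n) →
                               ∃[ D ] (Reachable C D × D r ≡ 1)

IsSmallest : (ℕ → Set) → ℕ → Set
IsSmallest P t = P t × (∀ s → P s → t ≤ s)

-- π(G) = t and πₛ(G) = t are rendered as relations between G and t, since
-- the existence of a smallest such t is not built into the definition.
IsPebblingNumber : ∀ {n} → Graph n → ℕ → Set
IsPebblingNumber G = IsSmallest (AlwaysSolvable G)

IsSingularPebblingNumber : ∀ {n} → Graph n → ℕ → Set
IsSingularPebblingNumber G = IsSmallest (AlwaysSingularlySolvable G)

{-# OPTIONS --safe #-}

-- An odd number of pebbles on the target r is brought down to one by moving pairs
-- from r to a neighbour v. If r carries 2k pebbles, moving all of them to v
-- leaves k + C v pebbles there; once this is at least 2, a move back makes r odd.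
-- On K₂, three pebbles guarantee k + C v ≥ 2. The configuration (2, 0), with its
-- first vertex as the target, admits only the move to (0, 1), so two do not suffice.
module Submission where

open import Defs
open import Data.Empty using (⊥-elim)
open import Data.Fin.Base using (Fin; zero; suc)
open import Data.Nat.Base using (ℕ; zero; suc; _+_; _*_; _∸_; _≤_; _<_; z≤n; s≤s)
open import Data.Nat.Properties
  using (+-comm; +-identityʳ; +-suc; ≤-reflexive; ≤-trans; ≤-pred; ≮⇒≥; <⇒≱; n≤1+n)
open import Data.Product.Base using (_×_; _,_; ∃-syntax)
open import Data.Sum.Base using (_⊎_; inj₁; inj₂)
open import Data.Vec.Functional using (updateAt; _∷_; [])
open import Data.Vec.Functional.Properties using (updateAt-updates; updateAt-minimal)
open import Relation.Binary.Construct.Closure.ReflexiveTransitive using (ε; _◅_)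
open import Relation.Binary.PropositionalEquality
  using (_≡_; _≢_; refl; sym; trans; cong; subst)
open import Relation.Nullary using (¬_)

parity : ∀ n → (∃[ k ] n ≡ k * 2) ⊎ (∃[ k ] n ≡ suc (k * 2))
parity zero = inj₁ (0 , refl)
parity (suc n) with parity n
... | inj₁ (k , eq) = inj₂ (k , cong suc eq)
... | inj₂ (k , eq) = inj₁ (suc k , cong suc eq)

-- If `k + c` is at most 1, then `k * 2 + c` is at most 2, with equality only for `k = 1`, `c = 0`;
-- this is where three pebbles rather than two are required.
3≤k*2+c⇒2≤k+c : ∀ k c → 3 ≤ k * 2 + c → 2 ≤ k + c
3≤k*2+c⇒2≤k+c zero          c       3≤c = ≤-trans (n≤1+n 2) 3≤c
3≤k*2+c⇒2≤k+c (suc zero)    zero    (s≤s (s≤s ()))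
3≤k*2+c⇒2≤k+c (suc zero)    (suc c) _   = s≤s (s≤s z≤n)
3≤k*2+c⇒2≤k+c (suc (suc k)) c       _   = s≤s (s≤s z≤n)

module _ {n : ℕ} (G : Graph n) where
  open Graph G

  transfer : Configuration n → Fin n → Fin n → Configuration n
  transfer C u v = updateAt (updateAt C u (_∸ 2)) v suc

  Adj⇒≢ : ∀ {u v} → Adj u v → u ≢ v
  Adj⇒≢ uv u≡v = irreflexive u≡v uv

  transfer-source : ∀ C {u v} → Adj u v → transfer C u v u ≡ C u ∸ 2
  transfer-source C {u} {v} uv =
    trans (updateAt-minimal u v _ (Adj⇒≢ uv)) (updateAt-updates u C)

  transfer-target : ∀ C {u v} → Adj u v → transfer C u v v ≡ suc (C v)
  transfer-target C {u} {v} uv =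
    trans (updateAt-updates v _)
          (cong suc (updateAt-minimal v u C (Adj⇒≢ (symmetric uv))))

  module _ {r v : Fin n} (rv : Adj r v) where

    -- Each move from `r` to `v` lowers the count on `r` by two, so `k` of them end at exactly one.
    odd⇒singular : ∀ k C → C r ≡ suc (k * 2) → ∃[ D ] (Reachable G C D × D r ≡ 1)
    odd⇒singular zero    C eq = C , ε , eq
    odd⇒singular (suc k) C eq
      with odd⇒singular k (transfer C r v) (trans (transfer-source C rv) (cong (_∸ 2) eq))
    ... | D , path , Dr≡1 =
      D , move r v rv (subst (2 ≤_) (sym eq) (s≤s (s≤s z≤n))) ◅ path , Dr≡1

    -- The sum `k + C v` is invariant under a move from `r` to `v`: `k` drops by one and `C v` rises
    -- by one. Hence `v` carries at least two pebbles once `r` is empty.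
    even⇒singular : ∀ k C → C r ≡ k * 2 → 2 ≤ k + C v →
                    ∃[ D ] (Reachable G C D × D r ≡ 1)
    even⇒singular zero C eq 2≤Cv
      -- Here `r` is empty, so one move back from `v` puts exactly one pebble on it.
      with odd⇒singular 0 (transfer C v r)
             (trans (transfer-target C (symmetric rv)) (cong suc eq))
    ... | D , path , Dr≡1 = D , move v r (symmetric rv) 2≤Cv ◅ path , Dr≡1
    even⇒singular (suc k) C eq 2≤k+Cv
      with even⇒singular k (transfer C r v)
             (trans (transfer-source C rv) (cong (_∸ 2) eq))
             (subst (2 ≤_)
               (sym (trans (cong (k +_) (transfer-target C rv)) (+-suc k (C v)))) 2≤k+Cv)
    ... | D , path , Dr≡1 =
      D , move r v rv (subst (2 ≤_) (sym eq) (s≤s (s≤s z≤n))) ◅ path , Dr≡1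

    adjacent-singular : ∀ C → 3 ≤ C r + C v → ∃[ D ] (Reachable G C D × D r ≡ 1)
    adjacent-singular C 3≤ with parity (C r)
    ... | inj₂ (k , eq) = odd⇒singular k C eq
    ... | inj₁ (k , eq) = even⇒singular k C eq
      (3≤k*2+c⇒2≤k+c k (C v) (subst (λ a → 3 ≤ a + C v) eq 3≤))

    adjacent-solvable : ∀ C → 2 ≤ C r + C v → ∃[ D ] (Reachable G C D × 1 ≤ D r)
    adjacent-solvable C 2≤ with C r in eq
    ... | suc a = C , ε , subst (1 ≤_) (sym eq) (s≤s z≤n)
    -- With `C r` replaced by zero, `2≤` says that `v` itself carries two pebbles.
    ... | zero  = transfer C v r , move v r (symmetric rv) 2≤ ◅ ε ,
      subst (1 ≤_) (sym (transfer-target C (symmetric rv))) (s≤s z≤n)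

  stuck : ∀ {C D} → (∀ u → C u < 2) → Reachable G C D → D ≡ C
  stuck C<2 ε                      = refl
  stuck C<2 (move u v _ 2≤Cu ◅ _) = ⊥-elim (<⇒≱ (C<2 u) 2≤Cu)

K₂ : Graph 2
K₂ = complete 2

K₂-neighbour : (r : Fin 2) →
               ∃[ v ] (r ≢ v × (∀ (C : Configuration 2) → size C ≡ C r + C v))
K₂-neighbour zero       =
  suc zero , (λ ()) , λ C → cong (C zero +_) (+-identityʳ _)
K₂-neighbour (suc zero) =
  zero , (λ ()) , λ C → trans (cong (C zero +_) (+-identityʳ _)) (+-comm (C zero) _)

K₂-solvable : AlwaysSolvable K₂ 2
K₂-solvable C size≡2 r with K₂-neighbour r
... | v , r≢v , size≡ =
  adjacent-solvable K₂ r≢v C (≤-reflexive (trans (sym size≡2) (size≡ C)))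

K₂-singularlySolvable : AlwaysSingularlySolvable K₂ 3
K₂-singularlySolvable C 3≤size r with K₂-neighbour r
... | v , r≢v , size≡ = adjacent-singular K₂ r≢v C (subst (3 ≤_) (size≡ C) 3≤size)

K₂-unsolvable : ∀ {s} → s < 2 → ¬ AlwaysSolvable K₂ s
-- All `s` pebbles lie on the first vertex and the second is the target; as `s < 2`, no move exists
-- and the target stays empty.
K₂-unsolvable {s} s<2 solve with solve (s ∷ 0 ∷ []) (+-identityʳ s) (suc zero)
... | D , path , 1≤D with stuck K₂ (λ { zero → s<2 ; (suc zero) → s≤s z≤n }) path
K₂-unsolvable s<2 solve | D , path , () | refl

two-pebbles-not-singular : ∀ {D} → Reachable K₂ (2 ∷ 0 ∷ []) D → D zero ≢ 1
two-pebbles-not-singular ε ()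
two-pebbles-not-singular (move (suc zero) _ _ () ◅ _) _
two-pebbles-not-singular (move zero zero 0≢0 _ ◅ _) _ = 0≢0 refl
two-pebbles-not-singular (move zero (suc zero) _ _ ◅ path) D0≡1
  with stuck K₂ (λ { zero → s≤s z≤n ; (suc zero) → s≤s (s≤s z≤n) }) path
two-pebbles-not-singular (move zero (suc zero) _ _ ◅ path) () | refl

K₂-not-singularlySolvable : ∀ {s} → s < 3 → ¬ AlwaysSingularlySolvable K₂ s
-- Singular solvability at `s` covers every configuration of at least `s` pebbles, so this single
-- one refutes all `s ≤ 2`.
K₂-not-singularlySolvable s<3 solve with solve (2 ∷ 0 ∷ []) (≤-pred s<3) zero
... | D , path , D0≡1 = two-pebbles-not-singular path D0≡1

mainTheorem3 : IsPebblingNumber (complete 2) 2 × IsSingularPebblingNumber (complete 2) 3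
mainTheorem3 =
  (K₂-solvable , λ s solve → ≮⇒≥ λ s<2 → K₂-unsolvable s<2 solve) ,
  (K₂-singularlySolvable , λ s solve → ≮⇒≥ λ s<3 → K₂-not-singularlySolvable s<3 solve)
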